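{- Let $\mathcal{H}=\{rrr,rrb\}$. Then, for every integer $n\ge 2$, $f(n)\le h_2(n,\mathcal{H})\le 2f(n)$.
   Context: Edge-colorings of the complete graph $K_n$ use colors from $\{r,b,y\}$ (red, blue, yellow); they need not be proper, and not all colors need be used. A pattern is an edge-colored triangle, denoted by the multiset of the colors of its three edges; e.g. $rrr$ is the all-red triangle and $rrb$ is the triangle with two red edges and one blue edge. For a family $\mathcal{H}$ of patterns, $\operatorname{Forb}(n,\mathcal{H})$ is the set of all edge-colorings of $K_n$ with colors from $\{r,b,y\}$ in which no triangle has a coloring belonging to $\mathcal{H}$. For an edge-coloring $c$ of $K_n$, $h_2(c)$ is the maximum $k$ such that there is a set of $k$ vertices whose induced edges use at most two of the three colors. Finally, $h_2(n,\mathcal{H})=\min\{h_2(c): c\in\operatorname{Forb}(n,\mathcal{H})\}$. For a graph $G$, $\alpha(G)$ and $\omega(G)$ denote the independence number and the clique number, and $G^2$ is the square of $G$: the graph on the same vertex set in which two distinct vertices are adjacent if and only if they are at distance at most $2$ in $G$. Define $f(G)=\max\{\alpha(G),\omega(G^2)\}$ and $f(n)=\min\{f(G): |V(G)|=n,\ \omega(G)=2\}$. -}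

module Defs where

open import Data.Fin using (Fin)
import Data.Fin.Properties as Fin
open import Data.Fin.Subset using (Subset; _∈_; ∣_∣) renaming (⊥ to ∅)
open import Data.Fin.Subset.Properties using (_∈?_; ∉⊥; ∣⊥∣≡0; ∣p∣≤n; anySubset?)
open import Data.List using (List; []; _∷_)
open import Data.List.Relation.Binary.Permutation.Propositional using (_↭_)
open import Data.List.Relation.Unary.Any using (Any)
open import Data.Nat using (ℕ; zero; suc; _≤_; _⊔_; s≤s; s≤s⁻¹)
open import Data.Nat.Properties using (≤-antisym; ≤∧≢⇒<; anyUpTo?; _≟_)
open import Data.Product using (∃; ∃₂; _×_; _,_; proj₁; proj₂)
open import Data.Sum using (_⊎_; inj₁; inj₂)
open import Data.Vec using (Vec; []; _∷_; toList)
open import Level using (Level; 0ℓ)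
open import Relation.Binary using (Rel; Symmetric; Irreflexive)
import Relation.Binary as B
open import Relation.Binary.PropositionalEquality
  using (_≡_; _≢_; refl; sym; ≢-sym)
open import Relation.Nullary using (¬_; Dec; yes; no; contradiction)
open import Relation.Nullary.Decidable using (map′; ¬?; _×-dec_; _⊎-dec_; _→-dec_)
open import Relation.Unary using (Pred; Decidable)

private
  variable
    ℓ : Level
    n : ℕ

IsMaximum : Pred ℕ ℓ → Pred ℕ ℓ
IsMaximum P k = P k × (∀ m → P m → m ≤ k)

IsMinimum : Pred ℕ ℓ → Pred ℕ ℓ
IsMinimum P k = P k × (∀ m → P m → k ≤ m)

IsMinimum-unique : {P : Pred ℕ ℓ} {j k : ℕ} → IsMinimum P j → IsMinimum P k → j ≡ k
IsMinimum-unique (pj , j≤) (pk , k≤) = ≤-antisym (j≤ _ pk) (k≤ _ pj)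

bounded-maximum : {P : Pred ℕ ℓ} → Decidable P → P 0 →
                  ∀ b → (∀ m → P m → m ≤ b) → ∃ (IsMaximum P)
bounded-maximum P? p0 zero    bound = 0 , p0 , bound
bounded-maximum P? p0 (suc b) bound with P? (suc b)
... | yes p = suc b , p , bound
... | no ¬p = bounded-maximum P? p0 b λ m pm →
  s≤s⁻¹ (≤∧≢⇒< (bound m pm) λ { refl → ¬p pm })

HasSize : Pred (Subset n) 0ℓ → Pred ℕ 0ℓ
HasSize P k = ∃ λ S → P S × ∣ S ∣ ≡ k

max-size : {P : Pred (Subset n) 0ℓ} → Decidable P → P ∅ → ∃ (IsMaximum (HasSize P))
max-size {n = n} P? p∅ = bounded-maximum
  (λ k → anySubset? λ S → P? S ×-dec (∣ S ∣ ≟ k))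
  (∅ , p∅ , ∣⊥∣≡0 n)
  n
  λ { _ (S , _ , refl) → ∣p∣≤n S }

Pairwise : Rel (Fin n) 0ℓ → Pred (Subset n) 0ℓ
Pairwise R S = ∀ u v → u ∈ S → v ∈ S → u ≢ v → R u v

pairwise? : {R : Rel (Fin n) 0ℓ} → B.Decidable R → Decidable (Pairwise R)
pairwise? R? S = Fin.all? λ u → Fin.all? λ v →
  (u ∈? S) →-dec ((v ∈? S) →-dec (¬? (u Fin.≟ v) →-dec R? u v))

pairwise-∅ : {R : Rel (Fin n) 0ℓ} → Pairwise R ∅
pairwise-∅ u v u∈ = contradiction u∈ ∉⊥

------------------------------------------------------------------------
-- Graphs

-- Decidability of adjacency costs no generality classically; it makes
-- α and ω computable.
record Graph (n : ℕ) : Set₁ where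
  infix 4 _~_ _~?_
  field
    _~_    : Rel (Fin n) 0ℓ
    _~?_   : B.Decidable _~_
    symm   : Symmetric _~_
    irrefl : Irreflexive _≡_ _~_

Clique : Graph n → Pred (Subset n) 0ℓ
Clique G = Pairwise (Graph._~_ G)

Independent : Graph n → Pred (Subset n) 0ℓ
Independent G = Pairwise λ u v → ¬ (Graph._~_ G u v)

ω-maximum : (G : Graph n) → ∃ (IsMaximum (HasSize (Clique G)))
ω-maximum G = max-size (pairwise? (Graph._~?_ G)) pairwise-∅

ω : Graph n → ℕ
ω G = proj₁ (ω-maximum G)

α-maximum : (G : Graph n) → ∃ (IsMaximum (HasSize (Independent G)))
α-maximum G = max-size (pairwise? λ u v → ¬? (Graph._~?_ G u v)) pairwise-∅

α : Graph n → ℕ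
α G = proj₁ (α-maximum G)

module _ (G : Graph n) where
  open Graph G

  Walk : ℕ → Rel (Fin n) 0ℓ
  Walk zero    u v = u ≡ v
  Walk (suc k) u v = ∃ λ w → u ~ w × Walk k w v

  walk? : ∀ k → B.Decidable (Walk k)
  walk? zero    u v = u Fin.≟ v
  walk? (suc k) u v = Fin.any? λ w → (u ~? w) ×-dec walk? k w v

  snoc : ∀ k {u v w} → Walk k u v → v ~ w → Walk (suc k) u w
  snoc zero    refl        e = _ , e , refl
  snoc (suc k) (x , d , p) e = x , d , snoc k p e

  walk-sym : ∀ k → Symmetric (Walk k)
  walk-sym zero    p           = sym p
  walk-sym (suc k) (w , e , p) = snoc k (walk-sym k p) (symm e)

  -- The distance is the least length of a walk, so it is at most d exactly
  -- when some walk has length at most d.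
  Distance≤ : ℕ → Rel (Fin n) 0ℓ
  Distance≤ d u v = ∃ λ k → k ≤ d × Walk k u v

  distance≤? : ∀ d → B.Decidable (Distance≤ d)
  distance≤? d u v = map′
    (λ (k , k<1+d , p) → k , s≤s⁻¹ k<1+d , p)
    (λ (k , k≤d , p) → k , s≤s k≤d , p)
    (anyUpTo? (λ k → walk? k u v) (suc d))

infix 8 _²

_² : Graph n → Graph n
G ² = record
  { _~_    = λ u v → u ≢ v × Distance≤ G 2 u v
  ; _~?_   = λ u v → ¬? (u Fin.≟ v) ×-dec distance≤? G 2 u v
  ; symm   = λ (u≢v , k , k≤2 , p) → ≢-sym u≢v , k , k≤2 , walk-sym G k p
  ; irrefl = λ u≡v (u≢v , _) → u≢v u≡v
  }

f : Graph n → ℕ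
f G = α G ⊔ ω (G ²)

-- The minimum over graphs is rendered as a relation, "f(n) = k"; its value is
-- unique by IsMinimum-unique, and it has none when no graph qualifies (n < 2).
f[_]≡_ : ℕ → ℕ → Set₁
f[ n ]≡ k = IsMinimum (λ m → ∃ λ (G : Graph n) → ω G ≡ 2 × f G ≡ m) k

------------------------------------------------------------------------
-- Edge-colorings

data Color : Set where
  r b y : Color

infix 4 _≟ᶜ_

_≟ᶜ_ : B.DecidableEquality Color
r ≟ᶜ r = yes refl
r ≟ᶜ b = no λ ()
r ≟ᶜ y = no λ ()
b ≟ᶜ r = no λ ()
b ≟ᶜ b = yes refl
b ≟ᶜ y = no λ ()
y ≟ᶜ r = no λ ()
y ≟ᶜ b = no λ ()
y ≟ᶜ y = yes refl

anyColor? : {P : Pred Color 0ℓ} → Decidable P → Dec (∃ P)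
anyColor? P? = map′
  (λ { (inj₁ p) → r , p
     ; (inj₂ (inj₁ p)) → b , p
     ; (inj₂ (inj₂ p)) → y , p })
  (λ { (r , p) → inj₁ p
     ; (b , p) → inj₂ (inj₁ p)
     ; (y , p) → inj₂ (inj₂ p) })
  (P? r ⊎-dec (P? b ⊎-dec P? y))

-- Values on the diagonal are meaningless and never consulted below.
record Coloring (n : ℕ) : Set where
  field
    color : Fin n → Fin n → Color
    symm  : ∀ u v → color u v ≡ color v u

open Coloring using (color)

-- A multiset of three colors: vectors are compared only up to permutation.
Pattern : Set
Pattern = Vec Color 3

infix 4 _≈ₚ_

_≈ₚ_ : Rel Pattern 0ℓ
p ≈ₚ q = toList p ↭ toList q

triangle : Coloring n → Fin n → Fin n → Fin n → Pattern
triangle c u v w = color c u v ∷ color c v w ∷ color c u w ∷ []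

Forb : (n : ℕ) → List Pattern → Pred (Coloring n) 0ℓ
Forb n H c = ∀ u v w → u ≢ v → v ≢ w → u ≢ w → ¬ Any (triangle c u v w ≈ₚ_) H

-- The two colors need not be distinct.
AtMostTwoColors : Coloring n → Pred (Subset n) 0ℓ
AtMostTwoColors c S =
  ∃₂ λ x x′ → Pairwise (λ u v → color c u v ≡ x ⊎ color c u v ≡ x′) S

h₂-maximum : (c : Coloring n) → ∃ (IsMaximum (HasSize (AtMostTwoColors c)))
h₂-maximum c = max-size
  (λ S → anyColor? λ x → anyColor? λ x′ →
    pairwise? (λ u v → (color c u v ≟ᶜ x) ⊎-dec (color c u v ≟ᶜ x′)) S)
  (r , r , pairwise-∅)

h₂ : Coloring n → ℕ
h₂ c = proj₁ (h₂-maximum c)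

-- "h₂(n, H) = k"; there is no value when Forb n H is empty.
h₂[_,_]≡_ : ℕ → List Pattern → ℕ → Set
h₂[ n , H ]≡ k = IsMinimum (λ m → ∃ λ (c : Coloring n) → Forb n H c × h₂ c ≡ m) k

rrr rrb : Pattern
rrr = r ∷ r ∷ r ∷ []
rrb = r ∷ r ∷ b ∷ []

{-# OPTIONS --safe #-}

-- In a coloring avoiding rrr and rrb, two red edges sharing a vertex span a
-- triangle whose third edge is yellow.  So the red graph G is triangle-free,
-- its independent sets see only blue and yellow, and the cliques of G² see only
-- red and yellow: this gives the lower bound (if no edge is red, two colors
-- suffice on all n vertices).  Conversely, color a triangle-free G red, the
-- rest of G² yellow and everything else blue.  A two-colored set without red
-- is independent in G, one without blue is a clique of G², and in one without
-- yellow the red edges form a matching, so that it splits into two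
-- independent sets.
module Submission where

open import Defs
open import Data.Nat using (ℕ; _≤_; _*_)
open import Data.List using ([]; _∷_)
open import Data.Product using (∃₂; _×_)

open import Data.Bool using (Bool; true; false)
import Data.Bool.Properties as Bool
open import Data.Fin using (Fin; zero; suc; _<_; _<?_)
import Data.Fin.Properties as Fin
open import Data.Fin.Subset
  using (Subset; _∈_; _∩_; _∪_; ∁; ⁅_⁆; ∣_∣; Nonempty; ⊤)
open import Data.Fin.Subset.Properties
  using ( _∈?_; anySubset?; nonempty?; Empty-unique; ∣⊥∣≡0; ∣⊤∣≡n; ∣p∣≤n; ∣⁅x⁆∣≡1
        ; ∣p∩q∣≤∣q∣; x∈p∩q⁻; x∈∁p⇒x∉p; x∈⁅x⁆; x∈⁅y⁆⇒x≡y; x∈p∪q⁺; x∈p∪q⁻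
        ; x∈p∧x≢y⇒x∈p-y; x∈p⇒∣p-x∣<∣p∣)
open import Data.List using (List; map)
open import Data.List.Relation.Binary.Permutation.Propositional using (↭-refl)
open import Data.List.Relation.Binary.Permutation.Propositional.Properties using (map⁺)
open import Data.List.Relation.Unary.Any using (Any; here; there)
open import Data.Nat using (zero; suc; _+_; _⊔_; z≤n; s≤s; s≤s⁻¹)
open import Data.Nat.ListAction using (sum)
open import Data.Nat.ListAction.Properties using (sum-↭)
open import Data.Nat.Properties
  using ( ≤-refl; ≤-reflexive; ≤-trans; ≤-antisym; ≮⇒≥; +-suc; +-mono-≤; +-monoˡ-≤
        ; +-identityʳ; m≤m⊔n; m≤n⊔m; ⊔-lub; m≤m+n; _≟_)
open import Data.Product using (∃; _,_; proj₁; proj₂)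
import Data.Sum as Sum
open import Data.Sum using (_⊎_; inj₁; inj₂; [_,_]′)
open import Data.Vec using (Vec; []; _∷_; lookup; tabulate; toList)
open import Data.Vec.Properties using (lookup∘tabulate; lookup⇒[]=; []=⇒lookup)
open import Function using (_∘_; mk⇔)
open import Level using (Level; 0ℓ)
open import Relation.Binary using (Rel; Symmetric; tri<; tri≈; tri>)
open import Relation.Binary.PropositionalEquality
  using (_≡_; _≢_; refl; sym; trans; cong; cong₂; subst; ≢-sym)
open import Relation.Nullary using (¬_; Dec; yes; no; does; contradiction)
open import Relation.Nullary.Decidable
  using (map′; ¬?; _×-dec_; _→-dec_; dec-true; does-⇔; decidable-stable)
open import Relation.Unary using (Pred; Decidable)

open Coloring using (color)

private
  variable
    ℓ : Level
    n : ℕ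

-- Least number principle by induction on the known witness: either 0 already works, or the
-- predicate is shifted down by one and the witness drops with it. Decidability makes it
-- constructive; it yields the existence of both minima below.
minimum : {P : Pred ℕ ℓ} → Decidable P → ∀ k → P k → ∃ (IsMinimum P)
minimum P? k       pk with P? 0
minimum P? k       pk | yes p0 = 0 , p0 , λ _ _ → z≤n
minimum P? zero    pk | no ¬p0 = contradiction pk ¬p0
minimum P? (suc k) pk | no ¬p0 with minimum (P? ∘ suc) k pk
... | j , pj , j≤ = suc j , pj , λ
  { zero    p0 → contradiction p0 ¬p0
  ; (suc m) pm → s≤s (j≤ m pm) }

-- Finite sets

-- Finiteness in the only form needed for an exhaustive search. It passes from entries to vectors,
-- so anything encodable as a vector of vectors can be searched.
Searchable : Set → Set₁
Searchable A = {P : Pred A 0ℓ} → Decidable P → Dec (∃ P)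

anyVec? : {A : Set} → Searchable A → ∀ {n} → Searchable (Vec A n)
anyVec? any? {zero}  P? = map′ (λ p → [] , p) (λ { ([] , p) → p }) (P? [])
anyVec? any? {suc n} P? = map′
  (λ (x , xs , p) → x ∷ xs , p)
  (λ { (x ∷ xs , p) → x , xs , p })
  (any? λ x → anyVec? any? λ xs → P? (x ∷ xs))

comprehension : {P : Pred (Fin n) 0ℓ} → Decidable P → Subset n
comprehension P? = tabulate (does ∘ P?)

module _ {P : Pred (Fin n) 0ℓ} (P? : Decidable P) {u : Fin n} where

  ∈-comprehension⁺ : P u → u ∈ comprehension P?
  ∈-comprehension⁺ p =
    lookup⇒[]= u _ (trans (lookup∘tabulate (does ∘ P?) u) (dec-true (P? u) p))

  ∈-comprehension⁻ : u ∈ comprehension P? → P u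
  ∈-comprehension⁻ u∈
    with P? u | trans (sym (lookup∘tabulate (does ∘ P?) u)) ([]=⇒lookup u∈)
  ... | yes p | _ = p
  ... | no _  | ()

∣p∣≤∣p∩q∣+∣p∩∁q∣ : (p q : Subset n) → ∣ p ∣ ≤ ∣ p ∩ q ∣ + ∣ p ∩ ∁ q ∣
∣p∣≤∣p∩q∣+∣p∩∁q∣ []          []          = z≤n
∣p∣≤∣p∩q∣+∣p∩∁q∣ (false ∷ p) (_     ∷ q) = ∣p∣≤∣p∩q∣+∣p∩∁q∣ p q
∣p∣≤∣p∩q∣+∣p∩∁q∣ (true  ∷ p) (true  ∷ q) = s≤s (∣p∣≤∣p∩q∣+∣p∩∁q∣ p q)
∣p∣≤∣p∩q∣+∣p∩∁q∣ (true  ∷ p) (false ∷ q) =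
  ≤-trans (s≤s (∣p∣≤∣p∩q∣+∣p∩∁q∣ p q)) (≤-reflexive (sym (+-suc _ _)))

0<∣p∣⇒Nonempty : (p : Subset n) → 1 ≤ ∣ p ∣ → Nonempty p
0<∣p∣⇒Nonempty {n} p 0<∣p∣ with nonempty? p
... | yes ne = ne
... | no ¬ne with Empty-unique ¬ne
... | refl = contradiction (subst (1 ≤_) (∣⊥∣≡0 n) 0<∣p∣) λ ()

-- Splitting `p` along a singleton costs at most one element, so distinct elements can be picked one
-- after another.
choose : ∀ {k} (p : Subset n) → suc k ≤ ∣ p ∣ → ∃ λ u → u ∈ p × k ≤ ∣ p ∩ ∁ ⁅ u ⁆ ∣
choose p k<∣p∣ with 0<∣p∣⇒Nonempty p (≤-trans (s≤s z≤n) k<∣p∣)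
... | u , u∈p = u , u∈p , s≤s⁻¹ (≤-trans k<∣p∣ (≤-trans (∣p∣≤∣p∩q∣+∣p∩∁q∣ p ⁅ u ⁆)
  (+-monoˡ-≤ _ (≤-trans (∣p∩q∣≤∣q∣ p ⁅ u ⁆) (≤-reflexive (∣⁅x⁆∣≡1 u))))))

∈∩∁⁅⁆⁻ : ∀ {u v} (p : Subset n) → v ∈ p ∩ ∁ ⁅ u ⁆ → v ∈ p × u ≢ v
∈∩∁⁅⁆⁻ {u = u} p v∈ with x∈p∩q⁻ p (∁ ⁅ u ⁆) v∈
... | v∈p , v∈∁ = v∈p , λ { refl → x∈∁p⇒x∉p v∈∁ (x∈⁅x⁆ u) }

threeElements : (p : Subset n) → 3 ≤ ∣ p ∣ →
  ∃ λ u → ∃₂ λ v w → u ∈ p × v ∈ p × w ∈ p × u ≢ v × v ≢ w × u ≢ w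
threeElements p 3≤∣p∣ with choose p 3≤∣p∣
... | u , u∈p , 2≤ with choose _ 2≤
... | v , v∈p-u , 1≤ with choose _ 1≤
... | w , w∈p-u-v , _ with ∈∩∁⁅⁆⁻ p v∈p-u | ∈∩∁⁅⁆⁻ _ w∈p-u-v
... | v∈p , u≢v | w∈p-u , v≢w with ∈∩∁⁅⁆⁻ p w∈p-u
... | w∈p , u≢w = u , v , w , u∈p , v∈p , w∈p , u≢v , v≢w , u≢w

-- Deleting a member strictly lowers the cardinality, and `v` survives the deletion of `u`.
twoElements⇒2≤ : ∀ {u v} {p : Subset n} → u ∈ p → v ∈ p → u ≢ v → 2 ≤ ∣ p ∣
twoElements⇒2≤ u∈p v∈p u≢v =
  ≤-trans (s≤s (≤-trans (s≤s z≤n) (x∈p⇒∣p-x∣<∣p∣ (x∈p∧x≢y⇒x∈p-y v∈p (≢-sym u≢v)))))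
          (x∈p⇒∣p-x∣<∣p∣ u∈p)

threeElements⇒3≤ : ∀ {u v w} {p : Subset n} →
  u ∈ p → v ∈ p → w ∈ p → u ≢ v → v ≢ w → u ≢ w → 3 ≤ ∣ p ∣
threeElements⇒3≤ u∈p v∈p w∈p u≢v v≢w u≢w =
  ≤-trans (s≤s (twoElements⇒2≤ (x∈p∧x≢y⇒x∈p-y v∈p (≢-sym u≢v))
                               (x∈p∧x≢y⇒x∈p-y w∈p (≢-sym u≢w)) v≢w))
          (x∈p⇒∣p-x∣<∣p∣ u∈p)

-- Trichotomy and symmetry allow assuming that the pair is in increasing order.
pairwise-ordered : {R : Rel (Fin n) 0ℓ} {S : Subset n} → Symmetric R →
  (∀ {u v} → u ∈ S → v ∈ S → u < v → R u v) → Pairwise R S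
pairwise-ordered R-sym R< u v u∈ v∈ u≢v with Fin.<-cmp u v
... | tri< u<v _ _ = R< u∈ v∈ u<v
... | tri≈ _ u≡v _ = contradiction u≡v u≢v
... | tri> _ _ v<u = R-sym (R< v∈ u∈ v<u)

module _ {P : Pred (Subset n) 0ℓ} {k : ℕ} (max : IsMaximum (HasSize P) k) where

  size≤maximum : ∀ {S} → P S → ∣ S ∣ ≤ k
  size≤maximum pS = proj₂ max _ (_ , pS , refl)

  maximum≤ : ∀ {m} → (∀ {S} → P S → ∣ S ∣ ≤ m) → k ≤ m
  maximum≤ bound with proj₁ max
  ... | _ , pS , refl = bound pS

-- Graphs

infix 4 _⊑_

_⊑_ : Graph n → Graph n → Set
G ⊑ H = ∀ {u v} → Graph._~_ G u v → Graph._~_ H u v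

α-antitone : {G H : Graph n} → G ⊑ H → α H ≤ α G
α-antitone {G = G} {H} G⊑H = maximum≤ (proj₂ (α-maximum H)) λ ind →
  size≤maximum (proj₂ (α-maximum G)) λ u v u∈ v∈ u≢v → ind u v u∈ v∈ u≢v ∘ G⊑H

ω-monotone : {G H : Graph n} → G ⊑ H → ω G ≤ ω H
ω-monotone {G = G} {H} G⊑H = maximum≤ (proj₂ (ω-maximum G)) λ cl →
  size≤maximum (proj₂ (ω-maximum H)) λ u v u∈ v∈ u≢v → G⊑H (cl u v u∈ v∈ u≢v)

walk-monotone : {G H : Graph n} → G ⊑ H → ∀ k {u v} → Walk G k u v → Walk H k u v
walk-monotone G⊑H zero    p           = p
walk-monotone {H = H} G⊑H (suc k) (w , e , p) = w , G⊑H e , walk-monotone {H = H} G⊑H k p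

²-monotone : {G H : Graph n} → G ⊑ H → G ² ⊑ H ²
²-monotone {H = H} G⊑H (u≢v , k , k≤2 , p) = u≢v , k , k≤2 , walk-monotone {H = H} G⊑H k p

ω-cong : {G H : Graph n} → G ⊑ H → H ⊑ G → ω G ≡ ω H
ω-cong {G = G} {H} G⊑H H⊑G =
  ≤-antisym (ω-monotone {G = G} {H} G⊑H) (ω-monotone {G = H} {G} H⊑G)

-- Mutual inclusion stands in for equality of graphs: two records with the same edges need not be
-- propositionally equal, yet `f` depends on the edges alone.
f-cong : {G H : Graph n} → G ⊑ H → H ⊑ G → f G ≡ f H
f-cong {G = G} {H} G⊑H H⊑G = cong₂ _⊔_
  (≤-antisym (α-antitone {G = H} {G} H⊑G) (α-antitone {G = G} {H} G⊑H))
  (ω-cong {G = G ²} {H ²} (²-monotone {G = G} {H} G⊑H) (²-monotone {G = H} {G} H⊑G))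

f≤n : (G : Graph n) → f G ≤ n
f≤n G = ⊔-lub (maximum≤ (proj₂ (α-maximum G)) λ {S} _ → ∣p∣≤n S)
              (maximum≤ (proj₂ (ω-maximum (G ²))) λ {S} _ → ∣p∣≤n S)

module _ (G : Graph n) where
  open Graph G

  ~⇒≢ : ∀ {u v} → u ~ v → u ≢ v
  ~⇒≢ u~v u≡v = irrefl u≡v u~v

  TriangleFree : Set
  TriangleFree = ∀ {u v w} → u ~ v → v ~ w → ¬ (u ~ w)

  -- Three members of a clique would form a triangle, which gives the upper bound; the ends of an
  -- edge form a clique of size 2.
  triangleFree∧edge⇒ω≡2 : TriangleFree → (∃₂ λ u v → u ~ v) → ω G ≡ 2
  triangleFree∧edge⇒ω≡2 free (u , v , u~v) = ≤-antisym
    (maximum≤ (proj₂ (ω-maximum G)) λ {S} cl → ≮⇒≥ λ 2<∣S∣ →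
      let x₁ , x₂ , x₃ , ∈₁ , ∈₂ , ∈₃ , ≢₁₂ , ≢₂₃ , ≢₁₃ = threeElements S 2<∣S∣ in
      free (cl x₁ x₂ ∈₁ ∈₂ ≢₁₂) (cl x₂ x₃ ∈₂ ∈₃ ≢₂₃) (cl x₁ x₃ ∈₁ ∈₃ ≢₁₃))
    (≤-trans
      (twoElements⇒2≤ (x∈p∪q⁺ (inj₁ (x∈⁅x⁆ u))) (x∈p∪q⁺ (inj₂ (x∈⁅x⁆ v))) (~⇒≢ u~v))
      (size≤maximum (proj₂ (ω-maximum G)) edge))
    where
    ∈edge⁻ : ∀ {w} → w ∈ ⁅ u ⁆ ∪ ⁅ v ⁆ → w ≡ u ⊎ w ≡ v
    ∈edge⁻ w∈ = Sum.map (x∈⁅y⁆⇒x≡y u) (x∈⁅y⁆⇒x≡y v) (x∈p∪q⁻ ⁅ u ⁆ ⁅ v ⁆ w∈)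

    edge : Clique G (⁅ u ⁆ ∪ ⁅ v ⁆)
    edge x x′ x∈ x′∈ x≢x′ with ∈edge⁻ x∈ | ∈edge⁻ x′∈
    ... | inj₁ refl | inj₁ refl = contradiction refl x≢x′
    ... | inj₁ refl | inj₂ refl = u~v
    ... | inj₂ refl | inj₁ refl = symm u~v
    ... | inj₂ refl | inj₂ refl = contradiction refl x≢x′

  ω≡2⇒triangleFree : ω G ≡ 2 → TriangleFree
  ω≡2⇒triangleFree ω≡2 {u} {v} {w} u~v v~w u~w = contradiction
    (≤-trans
      (threeElements⇒3≤ (x∈p∪q⁺ (inj₁ (x∈⁅x⁆ u)))
                        (x∈p∪q⁺ (inj₂ (x∈p∪q⁺ (inj₁ (x∈⁅x⁆ v)))))
                        (x∈p∪q⁺ (inj₂ (x∈p∪q⁺ (inj₂ (x∈⁅x⁆ w)))))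
                        (~⇒≢ u~v) (~⇒≢ v~w) (~⇒≢ u~w))
      (≤-trans (size≤maximum (proj₂ (ω-maximum G)) clique) (≤-reflexive ω≡2)))
    λ { (s≤s (s≤s ())) }
    where
    T : Subset n
    T = ⁅ u ⁆ ∪ (⁅ v ⁆ ∪ ⁅ w ⁆)

    ∈T⁻ : ∀ {x} → x ∈ T → x ≡ u ⊎ x ≡ v ⊎ x ≡ w
    ∈T⁻ x∈ = Sum.map (x∈⁅y⁆⇒x≡y u)
      (Sum.map (x∈⁅y⁆⇒x≡y v) (x∈⁅y⁆⇒x≡y w) ∘ x∈p∪q⁻ ⁅ v ⁆ ⁅ w ⁆)
      (x∈p∪q⁻ ⁅ u ⁆ _ x∈)

    clique : Clique G T
    clique x x′ x∈ x′∈ x≢x′ with ∈T⁻ x∈ | ∈T⁻ x′∈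
    ... | inj₁ refl        | inj₁ refl        = contradiction refl x≢x′
    ... | inj₁ refl        | inj₂ (inj₁ refl) = u~v
    ... | inj₁ refl        | inj₂ (inj₂ refl) = u~w
    ... | inj₂ (inj₁ refl) | inj₁ refl        = symm u~v
    ... | inj₂ (inj₁ refl) | inj₂ (inj₁ refl) = contradiction refl x≢x′
    ... | inj₂ (inj₁ refl) | inj₂ (inj₂ refl) = v~w
    ... | inj₂ (inj₂ refl) | inj₁ refl        = symm u~w
    ... | inj₂ (inj₂ refl) | inj₂ (inj₁ refl) = symm v~w
    ... | inj₂ (inj₂ refl) | inj₂ (inj₂ refl) = contradiction refl x≢x′

  ~⇒~² : ∀ {u v} → u ~ v → Graph._~_ (G ²) u v
  ~⇒~² u~v = ~⇒≢ u~v , 1 , s≤s z≤n , _ , u~v , refl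

  path⇒~² : ∀ {u v w} → u ~ v → v ~ w → u ≢ w → Graph._~_ (G ²) u w
  path⇒~² u~v v~w u≢w = u≢w , 2 , ≤-refl , _ , u~v , _ , v~w , refl

  -- A walk of length at most 2 between distinct vertices has length 1 or 2.
  ~²⇒edge⊎path : ∀ {u v} → Graph._~_ (G ²) u v → u ~ v ⊎ ∃ λ w → u ~ w × w ~ v
  ~²⇒edge⊎path (u≢v , 0 , _ , u≡v)                        = contradiction u≡v u≢v
  ~²⇒edge⊎path (_ , 1 , _ , _ , u~v , refl)               = inj₁ u~v
  ~²⇒edge⊎path (_ , 2 , _ , w , u~w , _ , w~v , refl)     = inj₂ (w , u~w , w~v)
  ~²⇒edge⊎path (_ , suc (suc (suc _)) , s≤s (s≤s ()) , _)

  -- Splitting each matching edge into its larger and its smaller end leaves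
  -- two independent sets.
  matching≤2α : {S : Subset n} →
    (∀ {u v w} → u ∈ S → v ∈ S → w ∈ S → u ~ v → v ~ w → u ≡ w) →
    ∣ S ∣ ≤ α G + α G
  matching≤2α {S} matching = ≤-trans (∣p∣≤∣p∩q∣+∣p∩∁q∣ S larger) (+-mono-≤
    (size≤maximum (proj₂ (α-maximum G)) larger-independent)
    (size≤maximum (proj₂ (α-maximum G)) rest-independent))
    where
    smallerPartner? : Decidable λ u → ∃ λ v → v ∈ S × v < u × v ~ u
    smallerPartner? u = Fin.any? λ v → (v ∈? S) ×-dec ((v <? u) ×-dec (v ~? u))

    larger : Subset n
    larger = comprehension smallerPartner?

    larger-independent : Independent G (S ∩ larger)
    larger-independent = pairwise-ordered (_∘ symm) λ u∈ v∈ u<v u~v →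
      let u∈S , u∈larger    = x∈p∩q⁻ S larger u∈
          v∈S , _           = x∈p∩q⁻ S larger v∈
          t , t∈S , t<u , t~u = ∈-comprehension⁻ smallerPartner? u∈larger
      -- The path `t`, `u`, `v` inside `S` forces `t ≡ v`, although `t < u < v`.
      in Fin.<⇒≢ (Fin.<-trans t<u u<v) (matching t∈S u∈S v∈S t~u u~v)

    rest-independent : Independent G (S ∩ ∁ larger)
    rest-independent = pairwise-ordered (_∘ symm) λ u∈ v∈ u<v u~v →
      let u∈S , _  = x∈p∩q⁻ S (∁ larger) u∈
          _ , v∈∁  = x∈p∩q⁻ S (∁ larger) v∈
      -- The smaller end `u` is itself the partner that places `v` in `larger`.
      in x∈∁p⇒x∉p v∈∁ (∈-comprehension⁺ smallerPartner? (_ , u∈S , u<v , u~v))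

-- Exhaustive search over graphs, and a graph with clique number 2

graphOf : Vec (Subset n) n → Graph n
graphOf M = record
  { _~_    = λ u v → u ≢ v × v ∈ lookup M u × u ∈ lookup M v
  ; _~?_   = λ u v → ¬? (u Fin.≟ v) ×-dec ((v ∈? lookup M u) ×-dec (u ∈? lookup M v))
  ; symm   = λ (u≢v , v∈ , u∈) → ≢-sym u≢v , u∈ , v∈
  ; irrefl = λ u≡v (u≢v , _) → u≢v u≡v
  }

neighborhoods : Graph n → Vec (Subset n) n
neighborhoods G = tabulate λ u → comprehension (Graph._~?_ G u)

module _ (G : Graph n) where
  open Graph G

  ∈-neighborhood⁺ : ∀ {u v} → u ~ v → v ∈ lookup (neighborhoods G) u
  ∈-neighborhood⁺ {u} u~v = subst (_ ∈_) (sym (lookup∘tabulate _ u)) (∈-comprehension⁺ (u ~?_) u~v)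

  ∈-neighborhood⁻ : ∀ {u v} → v ∈ lookup (neighborhoods G) u → u ~ v
  ∈-neighborhood⁻ {u} v∈ = ∈-comprehension⁻ (u ~?_) (subst (_ ∈_) (lookup∘tabulate _ u) v∈)

  ⊑graphOf : G ⊑ graphOf (neighborhoods G)
  ⊑graphOf u~v = ~⇒≢ G u~v , ∈-neighborhood⁺ u~v , ∈-neighborhood⁺ (symm u~v)

  graphOf⊑ : graphOf (neighborhoods G) ⊑ G
  graphOf⊑ (_ , v∈ , _) = ∈-neighborhood⁻ v∈

-- Adjacency is a relation and cannot be listed directly, so the search runs over vectors of
-- subsets; `graphOf` makes a graph of each by keeping mutual memberships of distinct vertices. A
-- graph and the copy rebuilt from its neighborhoods include each other, hence share `ω` and `f`.
f-value? : Decidable λ m → ∃ λ (G : Graph n) → ω G ≡ 2 × f G ≡ m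
f-value? m = map′
  (λ (M , p) → graphOf M , p)
  (λ (G , ω≡2 , f≡m) → neighborhoods G
    , trans (ω-cong {G = graphOf (neighborhoods G)} {G} (graphOf⊑ G) (⊑graphOf G)) ω≡2
    , trans (f-cong {G = graphOf (neighborhoods G)} {G} (graphOf⊑ G) (⊑graphOf G)) f≡m)
  (anyVec? anySubset? λ M → (ω (graphOf M) ≟ 2) ×-dec (f (graphOf M) ≟ m))

-- Vertex `zero` is joined to all others. Stating adjacency as a difference of Booleans exhibits the
-- bipartition.
star : Graph n
star = record
  { _~_    = λ u v → center u ≢ center v
  ; _~?_   = λ u v → ¬? (center u Bool.≟ center v)
  ; symm   = ≢-sym
  ; irrefl = λ { refl c≢c → c≢c refl }
  }
  where
  center : Fin n → Bool
  center zero    = true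
  center (suc _) = false

star-ω≡2 : ω (star {suc (suc n)}) ≡ 2
star-ω≡2 {n} = triangleFree∧edge⇒ω≡2 (star {suc (suc n)})
  -- Two Booleans that both differ from a third are equal, so no triangle exists.
  (λ u≁v v≁w u≁w → u≁w (trans (Bool.¬-not u≁v) (sym (Bool.¬-not (≢-sym v≁w)))))
  (zero , suc zero , λ ())

-- Colorings

H : List Pattern
H = rrr ∷ rrb ∷ []

-- Equivalent to membership in `Forb n H`, but free of permutations and visibly decidable.
RedPathsCloseYellow : Coloring n → Set
RedPathsCloseYellow c = ∀ u v w → u ≢ v → v ≢ w → u ≢ w →
  color c u v ≡ r → color c v w ≡ r → color c u w ≡ y

forb⇒redPathsCloseYellow : (c : Coloring n) → Forb n H c → RedPathsCloseYellow c
forb⇒redPathsCloseYellow c forb u v w u≢v v≢w u≢w uv≡r vw≡r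
  with color c u v | color c v w | color c u w | forb u v w u≢v v≢w u≢w
forb⇒redPathsCloseYellow c forb u v w u≢v v≢w u≢w refl refl | r | r | r | ¬any =
  contradiction (here ↭-refl) ¬any
forb⇒redPathsCloseYellow c forb u v w u≢v v≢w u≢w refl refl | r | r | b | ¬any =
  contradiction (there (here ↭-refl)) ¬any
forb⇒redPathsCloseYellow c forb u v w u≢v v≢w u≢w refl refl | r | r | y | ¬any = refl

-- Chosen so that the patterns of total weight at most 1 are exactly rrr and rrb.
weight : Color → ℕ
weight r = 0
weight b = 1
weight y = 2

totalWeight : Pattern → ℕ
totalWeight p = sum (map weight (toList p))

-- The total weight is invariant under permutation, so it replaces an analysis of all rearrangements
-- of the two patterns.
forbidden⇒light : {p : Pattern} → Any (p ≈ₚ_) H → totalWeight p ≤ 1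
forbidden⇒light (here p≈rrr)         = ≤-trans (≤-reflexive (sum-↭ (map⁺ weight p≈rrr))) z≤n
forbidden⇒light (there (here p≈rrb)) = ≤-reflexive (sum-↭ (map⁺ weight p≈rrb))

-- Weight at most 1 leaves room for a single blue edge and no yellow one. The alternatives record
-- which vertex is the middle of the red path: the second, the third or the first vertex of
-- `triangle`.
light⇒redPath : ∀ x₁ x₂ x₃ → totalWeight (x₁ ∷ x₂ ∷ x₃ ∷ []) ≤ 1 →
  (x₁ ≡ r × x₂ ≡ r × x₃ ≢ y) ⊎ (x₂ ≡ r × x₃ ≡ r × x₁ ≢ y) ⊎ (x₁ ≡ r × x₃ ≡ r × x₂ ≢ y)
light⇒redPath r r r _ = inj₁ (refl , refl , λ ())
light⇒redPath r r b _ = inj₁ (refl , refl , λ ())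
light⇒redPath r b r _ = inj₂ (inj₂ (refl , refl , λ ()))
light⇒redPath b r r _ = inj₂ (inj₁ (refl , refl , λ ()))
light⇒redPath r r y (s≤s ())
light⇒redPath r b b (s≤s ())
light⇒redPath r b y (s≤s ())
light⇒redPath r y _ (s≤s ())
light⇒redPath b r b (s≤s ())
light⇒redPath b r y (s≤s ())
light⇒redPath b b _ (s≤s ())
light⇒redPath b y _ (s≤s ())
light⇒redPath y _ _ (s≤s ())

redPathsCloseYellow⇒forb : (c : Coloring n) → RedPathsCloseYellow c → Forb n H c
redPathsCloseYellow⇒forb c closed u v w u≢v v≢w u≢w any
  with light⇒redPath _ _ _ (forbidden⇒light any)
... | inj₁ (uv≡r , vw≡r , uw≢y) = uw≢y (closed u v w u≢v v≢w u≢w uv≡r vw≡r)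
... | inj₂ (inj₁ (vw≡r , uw≡r , uv≢y)) = uv≢y (trans (Coloring.symm c u v)
  (closed v w u v≢w (≢-sym u≢w) (≢-sym u≢v) vw≡r (trans (Coloring.symm c w u) uw≡r)))
... | inj₂ (inj₂ (uv≡r , uw≡r , vw≢y)) = vw≢y
  (closed v u w (≢-sym u≢v) u≢w v≢w (trans (Coloring.symm c v u) uv≡r) uw≡r)

redPathsCloseYellow? : Decidable (RedPathsCloseYellow {n})
redPathsCloseYellow? c = Fin.all? λ u → Fin.all? λ v → Fin.all? λ w →
  ¬? (u Fin.≟ v) →-dec (¬? (v Fin.≟ w) →-dec (¬? (u Fin.≟ w) →-dec
  ((color c u v ≟ᶜ r) →-dec ((color c v w ≟ᶜ r) →-dec (color c u w ≟ᶜ y)))))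

forb? : Decidable (Forb n H)
forb? c = map′ (redPathsCloseYellow⇒forb c) (forb⇒redPathsCloseYellow c)
  (redPathsCloseYellow? c)

-- Exhaustive search over colorings

infix 4 _≗ᶜ_

_≗ᶜ_ : Rel (Coloring n) 0ℓ
c ≗ᶜ d = ∀ u v → color c u v ≡ color d u v

≗ᶜ-sym : {c d : Coloring n} → c ≗ᶜ d → d ≗ᶜ c
≗ᶜ-sym c≗d u v = sym (c≗d u v)

forb-resp : {c d : Coloring n} → c ≗ᶜ d → Forb n H c → Forb n H d
forb-resp {c = c} {d} c≗d forb = redPathsCloseYellow⇒forb d
  λ u v w u≢v v≢w u≢w uv≡r vw≡r → trans (sym (c≗d u w))
    (forb⇒redPathsCloseYellow c forb u v w u≢v v≢w u≢w
      (trans (c≗d u v) uv≡r) (trans (c≗d v w) vw≡r))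

h₂-mono : {c d : Coloring n} → c ≗ᶜ d → h₂ c ≤ h₂ d
h₂-mono {c = c} {d} c≗d = maximum≤ (proj₂ (h₂-maximum c)) λ (x , x′ , two) →
  size≤maximum (proj₂ (h₂-maximum d)) (x , x′ , λ u v u∈ v∈ u≢v →
    Sum.map (trans (sym (c≗d u v))) (trans (sym (c≗d u v))) (two u v u∈ v∈ u≢v))

h₂-cong : {c d : Coloring n} → c ≗ᶜ d → h₂ c ≡ h₂ d
h₂-cong {c = c} {d} c≗d =
  ≤-antisym (h₂-mono {c = c} {d} c≗d) (h₂-mono {c = d} {c} (≗ᶜ-sym {c = c} {d} c≗d))

-- Colorings are searched as symmetric matrices of colors. The matrix of a coloring gives it back
-- only up to pointwise equality, hence the demand that `P` respect `_≗ᶜ_`.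
anyColoring? : {P : Pred (Coloring n) 0ℓ} → Decidable P →
  (∀ {c d} → c ≗ᶜ d → P c → P d) → Dec (∃ P)
anyColoring? {n} {P} P? resp = map′
  (λ (M , s , p) → coloringOf M s , p)
  (λ (c , p) → colors c , colors-symmetric c , resp (λ u v → sym (lookup-colors c u v)) p)
  (anyVec? (anyVec? anyColor?) symmetric×P?)
  where
  entry : Vec (Vec Color n) n → Fin n → Fin n → Color
  entry M u v = lookup (lookup M u) v

  SymmetricMatrix : Pred (Vec (Vec Color n) n) 0ℓ
  SymmetricMatrix M = ∀ u v → entry M u v ≡ entry M v u

  coloringOf : ∀ M → SymmetricMatrix M → Coloring n
  coloringOf M s = record { color = entry M ; symm = s }

  symmetric×P? : Decidable λ M → ∃ λ (s : SymmetricMatrix M) → P (coloringOf M s)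
  symmetric×P? M with Fin.all? (λ u → Fin.all? (λ v → entry M u v ≟ᶜ entry M v u))
  ... | no ¬s = no λ (s , _) → ¬s s
  -- Two colorings built from the same matrix may differ in their symmetry proofs, but agree
  -- pointwise by `refl`.
  ... | yes s = map′ (s ,_) (λ (_ , p) → resp (λ _ _ → refl) p) (P? (coloringOf M s))

  colors : Coloring n → Vec (Vec Color n) n
  colors c = tabulate λ u → tabulate (color c u)

  lookup-colors : ∀ c u v → entry (colors c) u v ≡ color c u v
  lookup-colors c u v =
    trans (cong (λ xs → lookup xs v) (lookup∘tabulate _ u)) (lookup∘tabulate (color c u) v)

  colors-symmetric : ∀ c → SymmetricMatrix (colors c)
  colors-symmetric c u v =
    trans (lookup-colors c u v) (trans (Coloring.symm c u v) (sym (lookup-colors c v u)))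

h₂-value? : Decidable λ m → ∃ λ (c : Coloring n) → Forb n H c × h₂ c ≡ m
h₂-value? m = anyColoring? (λ c → forb? c ×-dec (h₂ c ≟ m))
  λ {c} {d} c≗d (forb , h₂≡m) →
    forb-resp {c = c} {d} c≗d forb , trans (sym (h₂-cong {c = c} {d} c≗d)) h₂≡m

-- From colorings to graphs

module _ (c : Coloring n) where

  redGraph : Graph n
  redGraph = record
    { _~_    = λ u v → u ≢ v × color c u v ≡ r
    ; _~?_   = λ u v → ¬? (u Fin.≟ v) ×-dec (color c u v ≟ᶜ r)
    ; symm   = λ {u} {v} (u≢v , uv≡r) → ≢-sym u≢v , trans (Coloring.symm c v u) uv≡r
    ; irrefl = λ u≡v (u≢v , _) → u≢v u≡v
    }

  nonRed⇒two : {S : Subset n} → Pairwise (λ u v → color c u v ≢ r) S → AtMostTwoColors c S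
  nonRed⇒two nonRed = b , y , λ u v u∈ v∈ u≢v → blueOrYellow (nonRed u v u∈ v∈ u≢v)
    where
    blueOrYellow : ∀ {x} → x ≢ r → x ≡ b ⊎ x ≡ y
    blueOrYellow {r} r≢r = contradiction refl r≢r
    blueOrYellow {b} _   = inj₁ refl
    blueOrYellow {y} _   = inj₂ refl

  size≤h₂ : {S : Subset n} → AtMostTwoColors c S → ∣ S ∣ ≤ h₂ c
  size≤h₂ = size≤maximum (proj₂ (h₂-maximum c))

  noRed⇒n≤h₂ : (∀ u v → u ≢ v → color c u v ≢ r) → n ≤ h₂ c
  noRed⇒n≤h₂ noRed = ≤-trans (≤-reflexive (sym (∣⊤∣≡n n)))
    (size≤h₂ (nonRed⇒two {⊤} λ u v _ _ → noRed u v))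

  module _ (closed : RedPathsCloseYellow c) where

    redGraph-triangleFree : TriangleFree redGraph
    redGraph-triangleFree (u≢v , uv≡r) (v≢w , vw≡r) (u≢w , uw≡r) =
      contradiction (trans (sym uw≡r) (closed _ _ _ u≢v v≢w u≢w uv≡r vw≡r)) λ ()

    f-redGraph≤h₂ : f redGraph ≤ h₂ c
    f-redGraph≤h₂ = ⊔-lub
      (maximum≤ (proj₂ (α-maximum redGraph)) λ ind →
        size≤h₂ (nonRed⇒two λ u v u∈ v∈ u≢v uv≡r → ind u v u∈ v∈ u≢v (u≢v , uv≡r)))
      (maximum≤ (proj₂ (ω-maximum (redGraph ²))) λ cl →
        size≤h₂ (r , y , λ u v u∈ v∈ u≢v → redOrYellow (cl u v u∈ v∈ u≢v)))
      where
      redOrYellow : ∀ {u v} → Graph._~_ (redGraph ²) u v → color c u v ≡ r ⊎ color c u v ≡ y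
      redOrYellow u~²v@(u≢v , _) with ~²⇒edge⊎path redGraph u~²v
      ... | inj₁ (_ , uv≡r) = inj₁ uv≡r
      ... | inj₂ (w , (u≢w , uw≡r) , (w≢v , wv≡r)) =
        inj₂ (closed _ w _ u≢w w≢v u≢v uw≡r wv≡r)

-- From graphs to colorings

-- Turns the use of at most two colors into the avoidance of one. When `x` and `x′` coincide, either
-- remaining color would do.
thirdColor : (x x′ : Color) → ∃ λ z → x ≢ z × x′ ≢ z
thirdColor r r = b , (λ ()) , λ ()
thirdColor r b = y , (λ ()) , λ ()
thirdColor r y = b , (λ ()) , λ ()
thirdColor b r = y , (λ ()) , λ ()
thirdColor b b = r , (λ ()) , λ ()
thirdColor b y = r , (λ ()) , λ ()
thirdColor y r = b , (λ ()) , λ ()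
thirdColor y b = r , (λ ()) , λ ()
thirdColor y y = r , (λ ()) , λ ()

-- Membership in the graph is tested first, because its edges also belong to the square.
edgeColor : (inG inG² : Bool) → Color
edgeColor true  _     = r
edgeColor false true  = y
edgeColor false false = b

module _ (G : Graph n) where
  open Graph G
  open Graph (G ²) using () renaming (_~_ to _~²_; _~?_ to _~²?_; symm to symm²)

  squareColoring : Coloring n
  squareColoring = record
    { color = λ u v → edgeColor (does (u ~? v)) (does (u ~²? v))
    ; symm  = λ u v → cong₂ edgeColor
        (does-⇔ (mk⇔ symm symm) (u ~? v) (v ~? u))
        (does-⇔ (mk⇔ symm² symm²) (u ~²? v) (v ~²? u))
    }

  -- Indexing by the color lets one match reveal the color together with its reason. Blue records
  -- only non-adjacency in the square, which implies non-adjacency in `G`.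
  data EdgeView (u v : Fin n) : Color → Set where
    red    : u ~ v → EdgeView u v r
    yellow : ¬ (u ~ v) → u ~² v → EdgeView u v y
    blue   : ¬ (u ~² v) → EdgeView u v b

  edgeView : ∀ u v → EdgeView u v (color squareColoring u v)
  edgeView u v = view (u ~? v) (u ~²? v)
    where
    view : (a? : Dec (u ~ v)) (b? : Dec (u ~² v)) →
           EdgeView u v (edgeColor (does a?) (does b?))
    view (yes u~v) _          = red u~v
    view (no u≁v)  (yes u~²v) = yellow u≁v u~²v
    view (no _)    (no u≁²v)  = blue u≁²v

  module _ (free : TriangleFree G) where

    -- The ends of a red path are adjacent in the square, so their edge is not blue;
    -- triangle-freeness excludes red.
    squareColoring-closed : RedPathsCloseYellow squareColoring
    squareColoring-closed u v w u≢v v≢w u≢w uv≡r vw≡r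
      with color squareColoring u v | edgeView u v
         | color squareColoring v w | edgeView v w
         | color squareColoring u w | edgeView u w
    squareColoring-closed u v w u≢v v≢w u≢w refl refl
      | _ | red u~v | _ | red v~w | _ | red u~w    = contradiction u~w (free u~v v~w)
    squareColoring-closed u v w u≢v v≢w u≢w refl refl
      | _ | red u~v | _ | red v~w | _ | yellow _ _ = refl
    squareColoring-closed u v w u≢v v≢w u≢w refl refl
      | _ | red u~v | _ | red v~w | _ | blue u≁²w  = contradiction (path⇒~² G u~v v~w u≢w) u≁²w

    private
      Avoids : Color → Pred (Subset n) 0ℓ
      Avoids x = Pairwise λ u v → color squareColoring u v ≢ x

    -- Avoiding red or blue gives a bound by a single `f G`; the factor 2 comes from avoiding
    -- yellow.
    avoids⇒≤2f : ∀ x {S} → Avoids x S → ∣ S ∣ ≤ 2 * f G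
    avoids⇒≤2f x {S} avoids = ≤-trans (bound x avoids)
      (≤-reflexive (cong (f G +_) (sym (+-identityʳ (f G)))))
      where
      α≤f : α G ≤ f G
      α≤f = m≤m⊔n (α G) (ω (G ²))

      bound : ∀ x → Avoids x S → ∣ S ∣ ≤ f G + f G
      bound r avoids = ≤-trans (size≤maximum (proj₂ (α-maximum G)) independent)
        (≤-trans α≤f (m≤m+n (f G) (f G)))
        where
        independent : Independent G S
        independent u v u∈ v∈ u≢v u~v
          with color squareColoring u v | edgeView u v | avoids u v u∈ v∈ u≢v
        ... | _ | red _        | r≢r = r≢r refl
        ... | _ | yellow u≁v _ | _   = u≁v u~v
        ... | _ | blue u≁²v    | _   = u≁²v (~⇒~² G u~v)
      bound b avoids = ≤-trans (size≤maximum (proj₂ (ω-maximum (G ²))) clique)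
        (≤-trans (m≤n⊔m (α G) (ω (G ²))) (m≤m+n (f G) (f G)))
        where
        clique : Clique (G ²) S
        clique u v u∈ v∈ u≢v
          with color squareColoring u v | edgeView u v | avoids u v u∈ v∈ u≢v
        ... | _ | red u~v       | _   = ~⇒~² G u~v
        ... | _ | yellow _ u~²v | _   = u~²v
        ... | _ | blue _        | b≢b = contradiction refl b≢b
      bound y avoids = ≤-trans (matching≤2α G matching) (+-mono-≤ α≤f α≤f)
        where
        matching : ∀ {u v w} → u ∈ S → v ∈ S → w ∈ S → u ~ v → v ~ w → u ≡ w
        -- If `u` and `w` were distinct, the red path through `v` would close with a yellow edge
        -- inside `S`.
        matching {u} {v} {w} u∈ v∈ w∈ u~v v~w = decidable-stable (u Fin.≟ w) λ u≢w →
          avoids u w u∈ w∈ u≢w (squareColoring-closed u v w (~⇒≢ G u~v) (~⇒≢ G v~w) u≢w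
            (edge⇒red u~v) (edge⇒red v~w))
          where
          edge⇒red : ∀ {s t} → s ~ t → color squareColoring s t ≡ r
          edge⇒red {s} {t} s~t with color squareColoring s t | edgeView s t
          ... | _ | red _        = refl
          ... | _ | yellow s≁t _ = contradiction s~t s≁t
          ... | _ | blue s≁²t    = contradiction (~⇒~² G s~t) s≁²t

    h₂-squareColoring≤2f : h₂ squareColoring ≤ 2 * f G
    h₂-squareColoring≤2f = maximum≤ (proj₂ (h₂-maximum squareColoring)) λ (x , x′ , two) →
      let z , x≢z , x′≢z = thirdColor x x′ in
      avoids⇒≤2f z λ u v u∈ v∈ u≢v uv≡z →
        [ (λ uv≡x → x≢z (trans (sym uv≡x) uv≡z))
        , (λ uv≡x′ → x′≢z (trans (sym uv≡x′) uv≡z)) ]′ (two u v u∈ v∈ u≢v)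

-- Existence of the two minima and the inequalities between them

f-attained : ∀ n → 2 ≤ n → ∃ λ a → f[ n ]≡ a
f-attained (suc (suc n)) _ =
  minimum f-value? (f (star {suc (suc n)})) (star , star-ω≡2 {n} , refl)
f-attained (suc zero) (s≤s ())

squareColoring-forb : (G : Graph n) → ω G ≡ 2 → Forb n H (squareColoring G)
squareColoring-forb G ω≡2 = redPathsCloseYellow⇒forb (squareColoring G)
  (squareColoring-closed G (ω≡2⇒triangleFree G ω≡2))

-- The red graph competes in the minimum defining `a` only if it has an edge, since `ω` must equal
-- 2. Without red edges, `a ≤ n` and `n ≤ h₂ c` close the gap.
f≤h₂ : ∀ {a} → f[ n ]≡ a → (c : Coloring n) → Forb n H c → a ≤ h₂ c
f≤h₂ ((G , _ , refl) , minimal) c forb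
  with Fin.any? (λ u → Fin.any? (λ v → Graph._~?_ (redGraph c) u v))
... | yes redEdge = ≤-trans
  (minimal _ (redGraph c
    , triangleFree∧edge⇒ω≡2 (redGraph c) (redGraph-triangleFree c closed) redEdge , refl))
  (f-redGraph≤h₂ c closed)
  where closed = forb⇒redPathsCloseYellow c forb
... | no ¬redEdge = ≤-trans (f≤n G)
  (noRed⇒n≤h₂ c λ u v u≢v uv≡r → ¬redEdge (u , v , u≢v , uv≡r))

h₂-attained : (G : Graph n) → ω G ≡ 2 → ∃ λ h → h₂[ n , H ]≡ h
h₂-attained G ω≡2 = minimum h₂-value? (h₂ (squareColoring G))
  (squareColoring G , squareColoring-forb G ω≡2 , refl)

minimal-f≤h₂ : ∀ {a h} → f[ n ]≡ a → h₂[ n , H ]≡ h → a ≤ h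
minimal-f≤h₂ f≡a ((c , forb , h₂c≡h) , _) = ≤-trans (f≤h₂ f≡a c forb) (≤-reflexive h₂c≡h)

minimal-h₂≤2f : ∀ {a h} → f[ n ]≡ a → h₂[ n , H ]≡ h → h ≤ 2 * a
minimal-h₂≤2f ((G , ω≡2 , fG≡a) , _) (_ , minimal) = ≤-trans
  (minimal (h₂ (squareColoring G)) (squareColoring G , squareColoring-forb G ω≡2 , refl))
  (≤-trans (h₂-squareColoring≤2f G (ω≡2⇒triangleFree G ω≡2))
           (≤-reflexive (cong (2 *_) fG≡a)))

lemma2p4 : (n : ℕ) → 2 ≤ n →
    ∃₂ λ a h → (f[ n ]≡ a) × (h₂[ n , rrr ∷ rrb ∷ [] ]≡ h) × a ≤ h × h ≤ 2 * a
lemma2p4 n 2≤n =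
  let a , f≡a = f-attained n 2≤n
      -- The graph attaining `a` also supplies a coloring in `Forb`, from which the search for `h`
      -- starts.
      (G , ω≡2 , _) , _ = f≡a
      h , h₂≡h = h₂-attained G ω≡2
  in a , h , f≡a , h₂≡h , minimal-f≤h₂ f≡a h₂≡h , minimal-h₂≤2f f≡a h₂≡h
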